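{- Let $k$ and $i$ be integers with $1\le i\le k/2$, $k\equiv 2\pmod 4$ and $i\equiv 3\pmod 4$. Then for all integers $n\ge 0$, $$S_{k,i}(4n+2)\equiv 0\pmod 4.$$
   Context: Write $(a;q)_\infty=\prod_{m\ge 0}(1-aq^m)$, $(a)_\infty=(a;q)_\infty$, and $(a_1,\ldots,a_r;q)_\infty=(a_1;q)_\infty\cdots(a_r;q)_\infty$. For integers $k,i$ with $1\le i\le k/2$, the integers $S_{k,i}(n)$, $n\ge 0$, are given by the generating function $$\sum_{n\ge 0}S_{k,i}(n)q^n=\frac{(-q)_\infty\,(q^i,q^{k-i},q^k;q^k)_\infty}{(q)_\infty}.$$ Combinatorially (an overpartition of $n$ is a partition of $n$ in which the first occurrence of each integer may be overlined): if $i<k/2$, $S_{k,i}(n)$ is the number of overpartitions of $n$ whose non-overlined parts are not congruent to $0,\pm i$ modulo $k$; if $i=k/2$, it is the number of overpartitions of $n$ with no part divisible by $k/2$. -}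

module Defs where

open import Data.Integer using (ℤ; +_; -_; 0ℤ; 1ℤ; _+_; _*_; _-_)
import Data.Integer.Properties as ℤ
open import Data.Integer.Tactic.RingSolver using (solve-∀)
open import Data.Nat as ℕ using (ℕ; zero; suc; _∸_; _<_; s≤s)
import Data.Nat.Properties as ℕ
open import Relation.Binary.PropositionalEquality using (_≡_; refl; trans; cong; cong₂)

-- Formal power series over ℤ: f n is the coefficient of q^n.
Series : Set
Series = ℕ → ℤ

-- (f - f(0)) / q
shift : Series → Series
shift f n = f (suc n)

1ˢ : Series
1ˢ zero    = 1ℤ
1ˢ (suc _) = 0ℤ

infixl 6 _-ˢ_
infixl 7 _⊛_ _÷_
infixr 8 _^ˢ_
infix 9 -ˢ_

-ˢ_ : Series → Series
(-ˢ f) n = - f n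

_-ˢ_ : Series → Series → Series
(f -ˢ g) n = f n - g n

-- Cauchy product: (f ⊛ g) n = Σ_{j ≤ n} f j * g (n - j), peeled off at j = 0.
_⊛_ : Series → Series → Series
(f ⊛ g) zero    = f 0 * g 0
(f ⊛ g) (suc n) = f 0 * g (suc n) + (shift f ⊛ g) n

_^ˢ_ : Series → ℕ → Series
f ^ˢ zero  = 1ˢ
f ^ˢ suc n = f ⊛ f ^ˢ n

-- q^ e is the monomial q^e.
q^_ : ℕ → Series
(q^ zero)  n       = 1ˢ n
(q^ suc e) zero    = 0ℤ
(q^ suc e) (suc n) = (q^ e) n

-- Long division. This is the quotient f / g when g has constant term 1
-- (see ÷-correct), the only case in which it is used.
_÷_ : Series → Series → Series
(f ÷ g) zero    = f 0
(f ÷ g) (suc n) = ((λ m → f (suc m) - f 0 * g (suc m)) ÷ g) n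

-- poch a b N = ∏_{m < N} (1 - a b^m)
poch : Series → Series → ℕ → Series
poch a b zero    = 1ˢ
poch a b (suc N) = poch a b N ⊛ (1ˢ -ˢ a ⊛ b ^ˢ N)

-- (a;b)_∞ = ∏_{m ≥ 0} (1 - a b^m) for b with constant term 0. Factors with
-- m > n are 1 + O(q^{n+1}), so the coefficient of q^n is already that of
-- the product over m ≤ n (see poch-stable).
⟨_⨾_⟩∞ : Series → Series → Series
⟨ a ⨾ b ⟩∞ n = poch a b (suc n) n

-- Σ_n S_{k,i}(n) q^n = (-q)_∞ (q^i, q^{k-i}, q^k; q^k)_∞ / (q)_∞.
-- The subtraction k ∸ i is exact, as i ≤ k/2 in all uses.
S : ℕ → ℕ → Series
S k i =
  ⟨ -ˢ (q^ 1) ⨾ q^ 1 ⟩∞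
    ⊛ (⟨ q^ i ⨾ q^ k ⟩∞ ⊛ ⟨ q^ (k ∸ i) ⨾ q^ k ⟩∞ ⊛ ⟨ q^ k ⨾ q^ k ⟩∞)
    ÷ ⟨ q^ 1 ⨾ q^ 1 ⟩∞

-- The rest of the file justifies the definitions of _÷_ and ⟨_⨾_⟩∞.

÷-correct : ∀ f g → g 0 ≡ 1ℤ → ∀ n → ((f ÷ g) ⊛ g) n ≡ f n
÷-correct f g g₀ zero    = trans (cong (f 0 *_) g₀) (ℤ.*-identityʳ (f 0))
÷-correct f g g₀ (suc n) = trans
  (cong (λ z → f 0 * g (suc n) + z) (÷-correct _ g g₀ n))
  (cancel (f 0 * g (suc n)) (f (suc n)))
  where
  cancel : ∀ x y → x + (y - x) ≡ y
  cancel = solve-∀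

Vanishes<_ : ℕ → Series → Set
(Vanishes< m) f = ∀ n → n < m → f n ≡ 0ℤ

⊛-vanishesʳ : ∀ {m} f g → (Vanishes< m) g → (Vanishes< m) (f ⊛ g)
⊛-vanishesʳ f g v zero    p = trans (cong (f 0 *_) (v 0 p)) (ℤ.*-zeroʳ (f 0))
⊛-vanishesʳ f g v (suc n) p = cong₂ _+_
  (trans (cong (f 0 *_) (v (suc n) p)) (ℤ.*-zeroʳ (f 0)))
  (⊛-vanishesʳ (shift f) g v n (ℕ.<-trans (ℕ.n<1+n n) p))

⊛-vanishes-suc : ∀ {m} f g → f 0 ≡ 0ℤ → (Vanishes< m) g → (Vanishes< suc m) (f ⊛ g)
⊛-vanishes-suc f g f₀ v zero    p       = trans (cong (_* g 0) f₀) (ℤ.*-zeroˡ (g 0))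
⊛-vanishes-suc f g f₀ v (suc n) (s≤s p) = cong₂ _+_
  (trans (cong (_* g (suc n)) f₀) (ℤ.*-zeroˡ (g (suc n))))
  (⊛-vanishesʳ (shift f) g v n p)

^ˢ-vanishes : ∀ b → b 0 ≡ 0ℤ → ∀ m → (Vanishes< m) (b ^ˢ m)
^ˢ-vanishes b b₀ zero    n ()
^ˢ-vanishes b b₀ (suc m) = ⊛-vanishes-suc b (b ^ˢ m) b₀ (^ˢ-vanishes b b₀ m)

⊛-1-vanishing : ∀ {m} f h → (Vanishes< m) h → ∀ n → n < m → (f ⊛ (1ˢ -ˢ h)) n ≡ f n
⊛-1-vanishing f h v zero    p =
  trans (cong (λ z → f 0 * (1ℤ - z)) (v 0 p)) (ℤ.*-identityʳ (f 0))
⊛-1-vanishing f h v (suc n) p = trans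
  (cong₂ _+_
    (trans (cong (λ z → f 0 * (0ℤ - z)) (v (suc n) p)) (ℤ.*-zeroʳ (f 0)))
    (⊛-1-vanishing (shift f) h v n (ℕ.<-trans (ℕ.n<1+n n) p)))
  (ℤ.+-identityˡ (f (suc n)))

poch-stable : ∀ a b → b 0 ≡ 0ℤ → ∀ n d → poch a b (d ℕ.+ suc n) n ≡ ⟨ a ⨾ b ⟩∞ n
poch-stable a b b₀ n zero    = refl
poch-stable a b b₀ n (suc d) = trans
  (⊛-1-vanishing (poch a b N) (a ⊛ b ^ˢ N) (⊛-vanishesʳ a (b ^ˢ N) (^ˢ-vanishes b b₀ N))
    n (ℕ.m≤n+m (suc n) d))
  (poch-stable a b b₀ n d)
  where N = d ℕ.+ suc n

S-correct : ∀ k i n →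
  (S k i ⊛ ⟨ q^ 1 ⨾ q^ 1 ⟩∞) n ≡
  (⟨ -ˢ (q^ 1) ⨾ q^ 1 ⟩∞
    ⊛ (⟨ q^ i ⨾ q^ k ⟩∞ ⊛ ⟨ q^ (k ∸ i) ⨾ q^ k ⟩∞ ⊛ ⟨ q^ k ⨾ q^ k ⟩∞)) n
S-correct k i = ÷-correct _ ⟨ q^ 1 ⨾ q^ 1 ⟩∞ refl

{-# OPTIONS --safe #-}

-- Put p = (q)_∞, r = (-q)_∞, T = (q^i, q^{k-i}, q^k; q^k)_∞ and φ = p / r. Euler's
-- identities give φ = (q, q, q²; q²)_∞, and r ≡ p (mod 2) gives r² ≡ p² (mod 4), so
-- that Σ S(n) q^n = T / φ ≡ φ T (mod 4). By the Jacobi triple product the exponents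
-- of φ are the squares d² ≡ 0, 1 (mod 4), while those of T are k d (d - 1) / 2 + l d
-- with l ∈ {i, k - i}, which are ≡ (d + 1)² - 1 ≡ 0, 3 (mod 4). Hence no term of φ T
-- has exponent ≡ 2 (mod 4).
--
-- The support of the triple product is read off the q-binomial expansion of
-- ∏_{m < 2N} (Q^N - q^i Q^m), Q = q^k, whose left side is, up to a monomial,
-- ∏_{m < N} (1 - q^i Q^m)(1 - q^{k-i} Q^m). After multiplication by (Q; Q)_∞ the
-- Gaussian binomials become 1 up to terms of high order.
module Submission where

open import Defs
open import Algebra.Bundles using (CommutativeRing)
open import Data.Integer as ℤ using (+_; 0ℤ; 1ℤ)
open import Data.Integer.Divisibility using (_∣_)
import Data.Integer.Divisibility.Signed as Signed
import Data.Integer.Properties as ℤ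
open import Data.Integer.Tactic.RingSolver using (solve-∀)
open import Data.Nat as ℕ using (ℕ; zero; suc; _≤_; _<_; z≤n; s≤s; _∸_; _%_)
open import Data.Nat.DivMod using (%-distribˡ-+; %-distribˡ-*; m%n<n; m<n⇒m%n≡m; [m+kn]%n≡m%n)
import Data.Nat.Properties as ℕ
import Data.Nat.Tactic.RingSolver as ℕ-Ring
open import Data.Product using (_,_; _×_; proj₁; proj₂; ∃-syntax)
open import Data.Sum using (_⊎_; inj₁; inj₂)
open import Level using (0ℓ)
open import Relation.Binary.PropositionalEquality as ≡ using (_≡_)
open import Relation.Nullary using (contradiction; yes; no)

-- tri n = n (n - 1) / 2.
tri : ℕ → ℕ
tri zero    = 0
tri (suc n) = n ℕ.+ tri n

-- Products, Gaussian binomials and quotients in a commutative ring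

module Products {c ℓ} (R : CommutativeRing c ℓ) where
  open CommutativeRing R hiding (zero)
  open import Algebra.Properties.CommutativeSemiring.Exp commutativeSemiring
    using (_^_; ^-congˡ; ^-homo-*; ^-assocʳ; ^-distrib-*)
  open import Algebra.Properties.Ring ring using (-‿distribˡ-*; -‿distribʳ-*)
  open import Algebra.Solver.Ring.NaturalCoefficients.Default commutativeSemiring
    using (solve; _:=_; _:+_; _:*_)
  open import Relation.Binary.Reasoning.Setoid setoid

  ∏ : Carrier → Carrier → Carrier → ℕ → Carrier
  ∏ x y q zero    = 1#
  ∏ x y q (suc M) = ∏ x y q M * (x + y * q ^ M)

  ∏-cong : ∀ {x x′ y y′ q q′} M → x ≈ x′ → y ≈ y′ → q ≈ q′ → ∏ x y q M ≈ ∏ x′ y′ q′ M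
  ∏-cong zero    ex ey eq = refl
  ∏-cong (suc M) ex ey eq =
    *-cong (∏-cong M ex ey eq) (+-cong ex (*-cong ey (^-congˡ M eq)))

  ∏-+ : ∀ x y q M N → ∏ x y q (N ℕ.+ M) ≈ ∏ x y q M * ∏ x (y * q ^ M) q N
  ∏-+ x y q M zero    = sym (*-identityʳ _)
  ∏-+ x y q M (suc N) = begin
    ∏ x y q (N ℕ.+ M) * (x + y * q ^ (N ℕ.+ M))
      ≈⟨ *-cong (∏-+ x y q M N) (+-congˡ (*-congˡ (^-homo-* q N M))) ⟩
    ∏ x y q M * ∏ x (y * q ^ M) q N * (x + y * (q ^ N * q ^ M))
      ≈⟨ solve 6 (λ p r x y s t → p :* r :* (x :+ y :* (s :* t)) := p :* (r :* (x :+ y :* t :* s)))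
           refl (∏ x y q M) (∏ x (y * q ^ M) q N) x y (q ^ N) (q ^ M) ⟩
    ∏ x y q M * (∏ x (y * q ^ M) q N * (x + y * q ^ M * q ^ N)) ∎

  ∏-front : ∀ x y q M → ∏ x y q (suc M) ≈ (x + y) * ∏ x (y * q) q M
  ∏-front x y q M = begin
    ∏ x y q (suc M)     ≈⟨ reflexive (≡.cong (∏ x y q) (ℕ.+-comm 1 M)) ⟩
    ∏ x y q (M ℕ.+ 1)   ≈⟨ ∏-+ x y q 1 M ⟩
    1# * (x + y * 1#) * ∏ x (y * (q * 1#)) q M
      ≈⟨ *-cong (trans (*-identityˡ _) (+-congˡ (*-identityʳ y)))
                (∏-cong M refl (*-congˡ (*-identityʳ q)) refl) ⟩
    (x + y) * ∏ x (y * q) q M ∎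

  ∏-scale : ∀ k x y q M → ∏ (k * x) (k * y) q M ≈ k ^ M * ∏ x y q M
  ∏-scale k x y q zero    = sym (*-identityʳ 1#)
  ∏-scale k x y q (suc M) = trans (*-congʳ (∏-scale k x y q M))
    (solve 6 (λ k x y p s t → t :* p :* (k :* x :+ k :* y :* s) := k :* t :* (p :* (x :+ y :* s)))
       refl k x y (∏ x y q M) (q ^ M) (k ^ M))

  ∏-reverse : ∀ y w q → y * w ≈ q → ∀ N →
    ∏ (q ^ N) y q N ≈ y ^ N * q ^ tri N * ∏ 1# w q N
  ∏-reverse y w q yw zero    = sym (trans (*-identityʳ _) (*-identityʳ _))
  ∏-reverse y w q yw (suc N) = begin
    ∏ (q * q ^ N) y q (suc N)
      ≈⟨ ∏-front (q * q ^ N) y q N ⟩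
    (q * q ^ N + y) * ∏ (q * q ^ N) (y * q) q N
      ≈⟨ *-cong (+-cong (*-congʳ (sym yw)) (sym (*-identityʳ y))) (∏-cong N refl (*-comm y q) refl) ⟩
    (y * w * q ^ N + y * 1#) * ∏ (q * q ^ N) (q * y) q N
      ≈⟨ *-congˡ (trans (∏-scale q (q ^ N) y q N) (*-congˡ (∏-reverse y w q yw N))) ⟩
    (y * w * q ^ N + y * 1#) * (q ^ N * (y ^ N * q ^ tri N * ∏ 1# w q N))
      ≈⟨ solve 7 (λ y w s o t u p →
           (y :* w :* s :+ y :* o) :* (s :* (t :* u :* p)) := y :* t :* (s :* u) :* (p :* (o :+ w :* s)))
           refl y w (q ^ N) 1# (y ^ N) (q ^ tri N) (∏ 1# w q N) ⟩
    y * y ^ N * (q ^ N * q ^ tri N) * (∏ 1# w q N * (1# + w * q ^ N))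
      ≈⟨ *-congʳ (*-congˡ (sym (^-homo-* q N (tri N)))) ⟩
    y * y ^ N * q ^ (N ℕ.+ tri N) * (∏ 1# w q N * (1# + w * q ^ N)) ∎

  ∏-double : ∀ y w q → y * w ≈ q → ∀ N →
    ∏ (q ^ N) y q (N ℕ.+ N) ≈
    y ^ N * q ^ tri N * (q ^ N) ^ N * (∏ 1# y q N * ∏ 1# w q N)
  ∏-double y w q yw N = begin
    ∏ (q ^ N) y q (N ℕ.+ N)
      ≈⟨ ∏-+ (q ^ N) y q N N ⟩
    ∏ (q ^ N) y q N * ∏ (q ^ N) (y * q ^ N) q N
      ≈⟨ *-cong (∏-reverse y w q yw N)
           (trans (∏-cong N (sym (*-identityʳ _)) (*-comm y (q ^ N)) refl) (∏-scale (q ^ N) 1# y q N)) ⟩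
    y ^ N * q ^ tri N * ∏ 1# w q N * ((q ^ N) ^ N * ∏ 1# y q N)
      ≈⟨ solve 4 (λ s w t y → s :* w :* (t :* y) := s :* t :* (y :* w))
           refl (y ^ N * q ^ tri N) (∏ 1# w q N) ((q ^ N) ^ N) (∏ 1# y q N) ⟩
    y ^ N * q ^ tri N * (q ^ N) ^ N * (∏ 1# y q N * ∏ 1# w q N) ∎

  ∏-even-odd : ∀ x y q N →
    ∏ x y q (N ℕ.* 2) ≈ ∏ x y (q * q) N * ∏ x (y * q) (q * q) N
  ∏-even-odd x y q zero    = sym (*-identityʳ 1#)
  ∏-even-odd x y q (suc N) = begin
    ∏ x y q (N ℕ.* 2) * (x + y * q ^ (N ℕ.* 2)) * (x + y * (q * q ^ (N ℕ.* 2)))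
      ≈⟨ *-cong (*-cong (∏-even-odd x y q N) (+-congˡ (*-congˡ e))) (+-congˡ (*-congˡ (*-congˡ e))) ⟩
    P * P′ * (x + y * s) * (x + y * (q * s))
      ≈⟨ solve 6 (λ p p′ x y q s →
           p :* p′ :* (x :+ y :* s) :* (x :+ y :* (q :* s)) :=
           p :* (x :+ y :* s) :* (p′ :* (x :+ y :* q :* s))) refl P P′ x y q s ⟩
    P * (x + y * s) * (P′ * (x + y * q * s)) ∎
    where
    P = ∏ x y (q * q) N
    P′ = ∏ x (y * q) (q * q) N
    s = (q * q) ^ N
    e : q ^ (N ℕ.* 2) ≈ s
    e = begin
      q ^ (N ℕ.* 2)    ≈⟨ reflexive (≡.cong (q ^_) (ℕ.*-comm N 2)) ⟩
      q ^ (2 ℕ.* N)    ≈⟨ ^-assocʳ q 2 N ⟨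
      (q * (q * 1#)) ^ N ≈⟨ ^-congˡ N (*-congˡ (*-identityʳ q)) ⟩
      s ∎

  telescope : ∀ a b → (1# - a) + a * (1# - b) ≈ 1# - a * b
  telescope a b = begin
    (1# - a) + a * (1# - b)       ≈⟨ +-congˡ (distribˡ a 1# (- b)) ⟩
    (1# - a) + (a * 1# + a * - b) ≈⟨ +-congˡ (+-cong (*-identityʳ a) (sym (-‿distribʳ-* a b))) ⟩
    (1# - a) + (a - a * b)        ≈⟨ solve 4 (λ o a a′ b → (o :+ a′) :+ (a :+ b) := o :+ (a′ :+ a) :+ b)
                                       refl 1# a (- a) (- (a * b)) ⟩
    1# + (- a + a) - a * b        ≈⟨ +-congʳ (trans (+-congˡ (-‿inverseˡ a)) (+-identityʳ 1#)) ⟩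
    1# - a * b ∎

  ∏-difference-of-squares : ∀ y q N →
    ∏ 1# y q N * ∏ 1# (- y) q N ≈ ∏ 1# (- (y * y)) (q * q) N
  ∏-difference-of-squares y q zero    = *-identityʳ 1#
  ∏-difference-of-squares y q (suc N) = begin
    P * (1# + y * s) * (P′ * (1# + - y * s))
      ≈⟨ solve 4 (λ p a p′ b → p :* a :* (p′ :* b) := p :* p′ :* (b :* a)) refl P (1# + y * s) P′ (1# + - y * s) ⟩
    P * P′ * ((1# + - y * s) * (1# + y * s))
      ≈⟨ *-cong (∏-difference-of-squares y q N) square ⟩
    ∏ 1# (- (y * y)) (q * q) N * (1# + - (y * y) * (q * q) ^ N) ∎
    where
    P = ∏ 1# y q N
    P′ = ∏ 1# (- y) q N
    s = q ^ N
    square : (1# + - y * s) * (1# + y * s) ≈ 1# + - (y * y) * (q * q) ^ N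
    square = begin
      (1# + - y * s) * (1# + y * s)
        ≈⟨ *-congʳ (+-congˡ (sym (-‿distribˡ-* y s))) ⟩
      (1# - y * s) * (1# + y * s)
        ≈⟨ trans (distribˡ _ 1# (y * s)) (+-cong (*-identityʳ _) (*-comm _ _)) ⟩
      (1# - y * s) + y * s * (1# - y * s)
        ≈⟨ telescope (y * s) (y * s) ⟩
      1# - y * s * (y * s)
        ≈⟨ +-congˡ (-‿cong (solve 2 (λ y s → y :* s :* (y :* s) := y :* y :* (s :* s)) refl y s)) ⟩
      1# - y * y * (s * s)
        ≈⟨ +-congˡ (trans (-‿distribˡ-* _ _) (*-congˡ (sym (^-distrib-* q q N)))) ⟩
      1# + - (y * y) * (q * q) ^ N ∎

  Σ⟨_⟩ : (ℕ → ℕ → Carrier) → ℕ → Carrier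
  Σ⟨ F ⟩ zero    = F 0 0
  Σ⟨ F ⟩ (suc M) = F 0 (suc M) + Σ⟨ (λ a b → F (suc a) b) ⟩ M

  Σ-cong : ∀ {F G} M → (∀ a b → a ℕ.+ b ≡ M → F a b ≈ G a b) → Σ⟨ F ⟩ M ≈ Σ⟨ G ⟩ M
  Σ-cong zero    e = e 0 0 ≡.refl
  Σ-cong (suc M) e = +-cong (e 0 (suc M) ≡.refl)
    (Σ-cong M (λ a b p → e (suc a) b (≡.cong suc p)))

  Σ-+ : ∀ F G M → Σ⟨ (λ a b → F a b + G a b) ⟩ M ≈ Σ⟨ F ⟩ M + Σ⟨ G ⟩ M
  Σ-+ F G zero    = refl
  Σ-+ F G (suc M) = trans (+-congˡ (Σ-+ _ _ M))
    (solve 4 (λ a b c d → a :+ b :+ (c :+ d) := a :+ c :+ (b :+ d)) refl _ _ _ _)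

  Σ-* : ∀ x F M → x * Σ⟨ F ⟩ M ≈ Σ⟨ (λ a b → x * F a b) ⟩ M
  Σ-* x F zero    = refl
  Σ-* x F (suc M) = trans (distribˡ x _ _) (+-congˡ (Σ-* x _ M))

  Σ-last : ∀ F M → Σ⟨ F ⟩ (suc M) ≈ Σ⟨ (λ a b → F a (suc b)) ⟩ M + F (suc M) 0
  Σ-last F zero    = refl
  Σ-last F (suc M) = trans (+-congˡ (Σ-last (λ a b → F (suc a) b) M)) (sym (+-assoc _ _ _))

  -- binom q a b is the Gaussian binomial coefficient [a + b; a].
  binom : Carrier → ℕ → ℕ → Carrier
  binom q zero    b       = 1#
  binom q (suc a) zero    = 1#
  binom q (suc a) (suc b) = binom q a (suc b) + q ^ suc a * binom q (suc a) b

  fac : Carrier → ℕ → Carrier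
  fac q = ∏ 1# (- q) q

  fac-suc : ∀ q n → fac q (suc n) ≈ fac q n * (1# - q ^ suc n)
  fac-suc q n = *-congˡ (+-congˡ (sym (-‿distribˡ-* q (q ^ n))))

  binom-fac : ∀ q a b → binom q a b * (fac q a * fac q b) ≈ fac q (a ℕ.+ b)
  binom-fac q zero    b       = trans (*-identityˡ _) (*-identityˡ _)
  binom-fac q (suc a) zero    = trans (trans (*-identityˡ _) (*-identityʳ _))
    (reflexive (≡.cong (fac q) (≡.sym (ℕ.+-identityʳ (suc a)))))
  binom-fac q (suc a) (suc b) = begin
    (B₁ + s * B₂) * (fac q (suc a) * fac q (suc b))
      ≈⟨ distribʳ _ _ _ ⟩
    B₁ * (fac q (suc a) * fac q (suc b)) + s * B₂ * (fac q (suc a) * fac q (suc b))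
      ≈⟨ +-cong (*-congˡ (*-congʳ (fac-suc q a))) (*-congˡ (*-congˡ (fac-suc q b))) ⟩
    B₁ * (fac q a * (1# - s) * fac q (suc b)) + s * B₂ * (fac q (suc a) * (fac q b * (1# - t)))
      ≈⟨ solve 9 (λ b₁ fa u fb′ s b₂ fa′ fb v →
           b₁ :* (fa :* u :* fb′) :+ s :* b₂ :* (fa′ :* (fb :* v)) :=
           b₁ :* (fa :* fb′) :* u :+ b₂ :* (fa′ :* fb) :* (s :* v)) refl
           B₁ (fac q a) (1# - s) (fac q (suc b)) s B₂ (fac q (suc a)) (fac q b) (1# - t) ⟩
    B₁ * (fac q a * fac q (suc b)) * (1# - s) + B₂ * (fac q (suc a) * fac q b) * (s * (1# - t))
      ≈⟨ +-cong (*-congʳ (binom-fac q a (suc b)))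
           (*-congʳ (trans (binom-fac q (suc a) b) (reflexive (≡.cong (fac q) (≡.sym (ℕ.+-suc a b)))))) ⟩
    fac q n * (1# - s) + fac q n * (s * (1# - t))
      ≈⟨ distribˡ _ _ _ ⟨
    fac q n * ((1# - s) + s * (1# - t))
      ≈⟨ *-congˡ (trans (telescope s t) (+-congˡ (-‿cong e))) ⟩
    fac q n * (1# - q ^ suc n)
      ≈⟨ fac-suc q n ⟨
    fac q (suc n) ∎
    where
    B₁ = binom q a (suc b)
    B₂ = binom q (suc a) b
    s = q ^ suc a
    t = q ^ suc b
    n = a ℕ.+ suc b
    e : s * t ≈ q ^ suc n
    e = sym (^-homo-* q (suc a) (suc b))

  term : Carrier → Carrier → Carrier → ℕ → ℕ → Carrier
  term x y q a b = q ^ tri a * y ^ a * x ^ b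

  term-sucˡ : ∀ x y q a b → term x y q (suc a) b ≈ y * term x (y * q) q a b
  term-sucˡ x y q a b = begin
    q ^ (a ℕ.+ tri a) * (y * y ^ a) * x ^ b
      ≈⟨ *-congʳ (*-congʳ (^-homo-* q a (tri a))) ⟩
    q ^ a * q ^ tri a * (y * y ^ a) * x ^ b
      ≈⟨ solve 5 (λ s t y u v → s :* t :* (y :* u) :* v := y :* (t :* (u :* s) :* v))
           refl (q ^ a) (q ^ tri a) y (y ^ a) (x ^ b) ⟩
    y * (q ^ tri a * (y ^ a * q ^ a) * x ^ b)
      ≈⟨ *-congˡ (*-congʳ (*-congˡ (^-distrib-* y q a))) ⟨
    y * (q ^ tri a * (y * q) ^ a * x ^ b) ∎

  term-twist : ∀ x y q a b → term x (y * q) q a b ≈ q ^ a * term x y q a b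
  term-twist x y q a b = begin
    q ^ tri a * (y * q) ^ a * x ^ b
      ≈⟨ *-congʳ (*-congˡ (^-distrib-* y q a)) ⟩
    q ^ tri a * (y ^ a * q ^ a) * x ^ b
      ≈⟨ solve 4 (λ s t u v → s :* (t :* u) :* v := u :* (s :* t :* v))
           refl (q ^ tri a) (y ^ a) (q ^ a) (x ^ b) ⟩
    q ^ a * (q ^ tri a * y ^ a * x ^ b) ∎

  term-sucʳ : ∀ x y q a b → term x y q a (suc b) ≈ x * term x y q a b
  term-sucʳ x y q a b =
    solve 3 (λ s x v → s :* (x :* v) := x :* (s :* v)) refl (q ^ tri a * y ^ a) x (x ^ b)

  q-binomial : ∀ x y q M → ∏ x y q M ≈ Σ⟨ (λ a b → term x y q a b * binom q a b) ⟩ M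
  q-binomial x y q zero    = sym (trans (*-identityʳ _) (trans (*-identityʳ _) (*-identityʳ _)))
  q-binomial x y q (suc M) = begin
    ∏ x y q (suc M)
      ≈⟨ ∏-front x y q M ⟩
    (x + y) * ∏ x (y * q) q M
      ≈⟨ *-congˡ (q-binomial x (y * q) q M) ⟩
    (x + y) * Σ⟨ G ⟩ M
      ≈⟨ trans (distribʳ _ x y) (+-cong (Σ-* x G M) (Σ-* y G M)) ⟩
    Σ⟨ (λ a b → x * G a b) ⟩ M + Σ⟨ (λ a b → y * G a b) ⟩ M
      ≈⟨ +-cong (trans (sym (+-identityʳ _)) (sym (Σ-last G₁ M))) (sym (+-identityˡ _)) ⟩
    Σ⟨ G₁ ⟩ (suc M) + Σ⟨ G₂ ⟩ (suc M)
      ≈⟨ Σ-+ G₁ G₂ (suc M) ⟨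
    Σ⟨ (λ a b → G₁ a b + G₂ a b) ⟩ (suc M)
      ≈⟨ Σ-cong (suc M) pascal ⟩
    Σ⟨ (λ a b → term x y q a b * binom q a b) ⟩ (suc M) ∎
    where
    G G₁ G₂ : ℕ → ℕ → Carrier
    G a b = term x (y * q) q a b * binom q a b
    G₁ a zero    = 0#
    G₁ a (suc b) = x * G a b
    G₂ zero    b = 0#
    G₂ (suc a) b = y * G a b
    from-y : ∀ a b → y * (term x (y * q) q a b * 1#) ≈ term x y q (suc a) b * 1#
    from-y a b = trans (sym (*-assoc _ _ _)) (*-congʳ (sym (term-sucˡ x y q a b)))
    pascal : ∀ a b → a ℕ.+ b ≡ suc M → G₁ a b + G₂ a b ≈ term x y q a b * binom q a b
    pascal zero    zero    ()
    pascal zero    (suc b) _ = begin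
      x * (term x (y * q) q 0 b * 1#) + 0#
        ≈⟨ +-identityʳ _ ⟩
      x * (term x y q 0 b * 1#)
        ≈⟨ trans (sym (*-assoc _ _ _)) (*-congʳ (sym (term-sucʳ x y q 0 b))) ⟩
      term x y q 0 (suc b) * 1# ∎
    pascal (suc zero)    zero _ = trans (+-identityˡ _) (from-y 0 0)
    pascal (suc (suc a)) zero _ = trans (+-identityˡ _) (from-y (suc a) 0)
    pascal (suc a) (suc b) _ = begin
      x * (term x (y * q) q (suc a) b * B₂) + y * (term x (y * q) q a (suc b) * B₁)
        ≈⟨ +-cong (*-congˡ (*-congʳ (term-twist x y q (suc a) b))) (sym (*-assoc _ _ _)) ⟩
      x * (q ^ suc a * term x y q (suc a) b * B₂) + y * term x (y * q) q a (suc b) * B₁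
        ≈⟨ +-cong (solve 4 (λ x s t b → x :* (s :* t :* b) := x :* t :* (s :* b))
                     refl x (q ^ suc a) (term x y q (suc a) b) B₂)
                  (*-congʳ (sym (term-sucˡ x y q a (suc b)))) ⟩
      x * term x y q (suc a) b * (q ^ suc a * B₂) + term x y q (suc a) (suc b) * B₁
        ≈⟨ +-congʳ (*-congʳ (sym (term-sucʳ x y q (suc a) b))) ⟩
      term x y q (suc a) (suc b) * (q ^ suc a * B₂) + term x y q (suc a) (suc b) * B₁
        ≈⟨ trans (+-comm _ _) (sym (distribˡ _ _ _)) ⟩
      term x y q (suc a) (suc b) * (B₁ + q ^ suc a * B₂) ∎
      where
      B₁ = binom q a (suc b)
      B₂ = binom q (suc a) b

  finite-triple-product : ∀ y w q → y * w ≈ q → ∀ N →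
    y ^ N * q ^ tri N * (q ^ N) ^ N * (∏ 1# y q N * ∏ 1# w q N) ≈
    Σ⟨ (λ a b → term (q ^ N) y q a b * binom q a b) ⟩ (N ℕ.+ N)
  finite-triple-product y w q yw N =
    trans (sym (∏-double y w q yw N)) (q-binomial (q ^ N) y q (N ℕ.+ N))

  halfGap : Carrier → Carrier → ℕ → Carrier
  halfGap y q zero    = 0#
  halfGap y q (suc N) =
    ∏ 1# y q N * - (y * q ^ N) + halfGap y q N * (1# + - y * q ^ N)

  ∏-neg : ∀ y q N → ∏ 1# (- y) q N ≈ ∏ 1# y q N + (halfGap y q N + halfGap y q N)
  ∏-neg y q zero    = sym (trans (+-congˡ (+-identityʳ 0#)) (+-identityʳ 1#))
  ∏-neg y q (suc N) = begin
    ∏ 1# (- y) q N * f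
      ≈⟨ *-congʳ (∏-neg y q N) ⟩
    (P + (h + h)) * f
      ≈⟨ trans (distribʳ f P (h + h)) (+-cong (*-congˡ step) (distribʳ f h h)) ⟩
    P * ((1# + z) + (- z + - z)) + (h * f + h * f)
      ≈⟨ solve 4 (λ p c m k → p :* (c :+ (m :+ m)) :+ (k :+ k) := p :* c :+ ((p :* m :+ k) :+ (p :* m :+ k)))
           refl P (1# + z) (- z) (h * f) ⟩
    P * (1# + z) + ((P * - z + h * f) + (P * - z + h * f)) ∎
    where
    P = ∏ 1# y q N
    h = halfGap y q N
    z = y * q ^ N
    f = 1# + - y * q ^ N
    step : f ≈ (1# + z) + (- z + - z)
    step = begin
      1# + - y * q ^ N        ≈⟨ +-congˡ (-‿distribˡ-* y (q ^ N)) ⟨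
      1# + - z                ≈⟨ +-congʳ (trans (+-congˡ (-‿inverseʳ z)) (+-identityʳ 1#)) ⟨
      1# + (z + - z) + - z    ≈⟨ solve 3 (λ o z m → o :+ (z :+ m) :+ m := (o :+ z) :+ (m :+ m)) refl 1# z (- z) ⟩
      (1# + z) + (- z + - z)  ∎

  -- With φ = p / r, the difference r² - p² = 4 (p h + h²) shows 1 / φ ≈ φ modulo 4.
  quotient-mod-4 : ∀ {s t p r o e h u v} →
    s * p ≈ r * t → p ≈ o * e → r * p ≈ e → r ≈ p + (h + h) → p * u ≈ 1# → r * v ≈ 1# →
    ∃[ z ] s ≈ (o * o * e) * t + ((z + z) + (z + z))
  quotient-mod-4 {s} {t} {p} {r} {o} {e} {h} {u} {v} sp p≈oe rp≈e r≈ pu rv = z , (begin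
    s                            ≈⟨ trans (*-congˡ uvpr) (*-identityʳ s) ⟨
    s * (u * v * (p * r))        ≈⟨ solve 5 (λ s u v p r → s :* (u :* v :* (p :* r)) := u :* v :* (s :* p :* r)) refl s u v p r ⟩
    u * v * (s * p * r)          ≈⟨ *-congˡ (*-congʳ sp) ⟩
    u * v * (r * t * r)          ≈⟨ *-congˡ (solve 2 (λ r t → r :* t :* r := r :* r :* t) refl r t) ⟩
    u * v * (r * r * t)          ≈⟨ *-congˡ (*-congʳ (*-cong r≈ r≈)) ⟩
    u * v * ((p + (h + h)) * (p + (h + h)) * t)
      ≈⟨ solve 4 (λ w p h t →
           w :* ((p :+ (h :+ h)) :* (p :+ (h :+ h)) :* t) :=
           w :* (p :* p :* t) :+ ((w :* ((p :* h :+ h :* h) :* t) :+ w :* ((p :* h :+ h :* h) :* t)) :+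
             (w :* ((p :* h :+ h :* h) :* t) :+ w :* ((p :* h :+ h :* h) :* t)))) refl (u * v) p h t ⟩
    u * v * (p * p * t) + ((z + z) + (z + z))
      ≈⟨ +-congʳ (*-congˡ (*-congʳ (*-congˡ p≈rφ))) ⟩
    u * v * (p * (r * φ) * t) + ((z + z) + (z + z))
      ≈⟨ +-congʳ (solve 5 (λ w p r f t → w :* (p :* (r :* f) :* t) := w :* (p :* r) :* (f :* t)) refl (u * v) p r φ t) ⟩
    u * v * (p * r) * (φ * t) + ((z + z) + (z + z))
      ≈⟨ +-congʳ (trans (*-congʳ uvpr) (*-identityˡ _)) ⟩
    φ * t + ((z + z) + (z + z)) ∎)
    where
    φ = o * o * e
    z = u * v * ((p * h + h * h) * t)
    uvpr : u * v * (p * r) ≈ 1#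
    uvpr = trans (solve 4 (λ u v p r → u :* v :* (p :* r) := p :* u :* (r :* v)) refl u v p r)
      (trans (*-cong pu rv) (*-identityʳ 1#))
    p≈rφ : p ≈ r * φ
    p≈rφ = begin
      p                 ≈⟨ p≈oe ⟩
      o * e             ≈⟨ *-congˡ rp≈e ⟨
      o * (r * p)       ≈⟨ *-congˡ (*-congˡ p≈oe) ⟩
      o * (r * (o * e)) ≈⟨ solve 3 (λ o r e → o :* (r :* (o :* e)) := r :* (o :* o :* e)) refl o r e ⟩
      r * (o * o * e)   ∎

open ≡ using (_≢_; refl; sym; trans; cong; cong₂; subst; module ≡-Reasoning)

-- The ring of power series

infix 4 _≈_
record _≈_ (f g : Series) : Set where
  constructor pointwise
  field at : ∀ n → f n ≡ g n
open _≈_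

infixl 6 _+ˢ_
_+ˢ_ : Series → Series → Series
(f +ˢ g) n = f n ℤ.+ g n

0ˢ : Series
0ˢ _ = 0ℤ

⊛-cong≤ : ∀ {f f′ g g′} n → (∀ m → m ≤ n → f m ≡ f′ m) → (∀ m → m ≤ n → g m ≡ g′ m) →
  (f ⊛ g) n ≡ (f′ ⊛ g′) n
⊛-cong≤ zero    ef eg = cong₂ ℤ._*_ (ef 0 z≤n) (eg 0 z≤n)
⊛-cong≤ (suc n) ef eg = cong₂ ℤ._+_
  (cong₂ ℤ._*_ (ef 0 z≤n) (eg (suc n) ℕ.≤-refl))
  (⊛-cong≤ n (λ m p → ef (suc m) (s≤s p)) (λ m p → eg m (ℕ.m≤n⇒m≤1+n p)))

⊛-zero : ∀ f g n → (∀ a b → a ℕ.+ b ≡ n → f a ≡ 0ℤ ⊎ g b ≡ 0ℤ) → (f ⊛ g) n ≡ 0ℤ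
⊛-zero f g n z = go f n z
  where
  product-zero : ∀ {x y} → x ≡ 0ℤ ⊎ y ≡ 0ℤ → x ℤ.* y ≡ 0ℤ
  product-zero     (inj₁ refl) = refl
  product-zero {x} (inj₂ refl) = ℤ.*-zeroʳ x
  go : ∀ f n → (∀ a b → a ℕ.+ b ≡ n → f a ≡ 0ℤ ⊎ g b ≡ 0ℤ) → (f ⊛ g) n ≡ 0ℤ
  go f zero    z = product-zero (z 0 0 refl)
  go f (suc n) z = cong₂ ℤ._+_ (product-zero (z 0 (suc n) refl))
    (go (shift f) n (λ a b p → z (suc a) b (cong suc p)))

⊛-last : ∀ f g n → (f ⊛ g) (suc n) ≡ (f ⊛ shift g) n ℤ.+ f (suc n) ℤ.* g 0
⊛-last f g zero    = refl
⊛-last f g (suc n) = trans (cong (λ x → f 0 ℤ.* g (suc (suc n)) ℤ.+ x) (⊛-last (shift f) g n))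
  (sym (ℤ.+-assoc (f 0 ℤ.* g (suc (suc n))) _ _))

⊛-comm : ∀ f g n → (f ⊛ g) n ≡ (g ⊛ f) n
⊛-comm f g zero    = ℤ.*-comm (f 0) (g 0)
⊛-comm f g (suc n) = begin
  f 0 ℤ.* g (suc n) ℤ.+ (shift f ⊛ g) n ≡⟨ cong₂ ℤ._+_ (ℤ.*-comm (f 0) (g (suc n))) (⊛-comm (shift f) g n) ⟩
  g (suc n) ℤ.* f 0 ℤ.+ (g ⊛ shift f) n ≡⟨ ℤ.+-comm (g (suc n) ℤ.* f 0) _ ⟩
  (g ⊛ shift f) n ℤ.+ g (suc n) ℤ.* f 0 ≡⟨ ⊛-last g f n ⟨
  (g ⊛ f) (suc n) ∎
  where open ≡-Reasoning

⊛-linearˡ : ∀ c f g h n → ((λ m → c ℤ.* f m ℤ.+ g m) ⊛ h) n ≡ c ℤ.* (f ⊛ h) n ℤ.+ (g ⊛ h) n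
⊛-linearˡ c f g h zero    = lem c (f 0) (g 0) (h 0)
  where
  lem : ∀ c x y z → (c ℤ.* x ℤ.+ y) ℤ.* z ≡ c ℤ.* (x ℤ.* z) ℤ.+ y ℤ.* z
  lem = solve-∀
⊛-linearˡ c f g h (suc n) =
  trans (cong (λ x → (c ℤ.* f 0 ℤ.+ g 0) ℤ.* h (suc n) ℤ.+ x) (⊛-linearˡ c (shift f) (shift g) h n))
    (lem c (f 0) (g 0) (h (suc n)) _ _)
  where
  lem : ∀ c x y z u v → (c ℤ.* x ℤ.+ y) ℤ.* z ℤ.+ (c ℤ.* u ℤ.+ v) ≡ c ℤ.* (x ℤ.* z ℤ.+ u) ℤ.+ (y ℤ.* z ℤ.+ v)
  lem = solve-∀

⊛-assoc : ∀ f g h n → ((f ⊛ g) ⊛ h) n ≡ (f ⊛ (g ⊛ h)) n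
⊛-assoc f g h zero    = ℤ.*-assoc (f 0) (g 0) (h 0)
⊛-assoc f g h (suc n) = begin
  f 0 ℤ.* g 0 ℤ.* h (suc n) ℤ.+ (shift (f ⊛ g) ⊛ h) n
    ≡⟨ cong (λ x → f 0 ℤ.* g 0 ℤ.* h (suc n) ℤ.+ x) (⊛-linearˡ (f 0) (shift g) (shift f ⊛ g) h n) ⟩
  f 0 ℤ.* g 0 ℤ.* h (suc n) ℤ.+ (f 0 ℤ.* (shift g ⊛ h) n ℤ.+ ((shift f ⊛ g) ⊛ h) n)
    ≡⟨ cong (λ x → f 0 ℤ.* g 0 ℤ.* h (suc n) ℤ.+ (f 0 ℤ.* (shift g ⊛ h) n ℤ.+ x)) (⊛-assoc (shift f) g h n) ⟩
  f 0 ℤ.* g 0 ℤ.* h (suc n) ℤ.+ (f 0 ℤ.* (shift g ⊛ h) n ℤ.+ (shift f ⊛ (g ⊛ h)) n)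
    ≡⟨ lem (f 0) (g 0) (h (suc n)) _ _ ⟩
  f 0 ℤ.* (g 0 ℤ.* h (suc n) ℤ.+ (shift g ⊛ h) n) ℤ.+ (shift f ⊛ (g ⊛ h)) n ∎
  where
  open ≡-Reasoning
  lem : ∀ x y z u v → x ℤ.* y ℤ.* z ℤ.+ (x ℤ.* u ℤ.+ v) ≡ x ℤ.* (y ℤ.* z ℤ.+ u) ℤ.+ v
  lem = solve-∀

⊛-identityˡ : ∀ f n → (1ˢ ⊛ f) n ≡ f n
⊛-identityˡ f zero    = ℤ.*-identityˡ (f 0)
⊛-identityˡ f (suc n) = trans
  (cong₂ ℤ._+_ (ℤ.*-identityˡ (f (suc n))) (⊛-zero (shift 1ˢ) f n (λ _ _ _ → inj₁ refl)))
  (ℤ.+-identityʳ (f (suc n)))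

⊛-distribʳ : ∀ h f g n → ((f +ˢ g) ⊛ h) n ≡ (f ⊛ h) n ℤ.+ (g ⊛ h) n
⊛-distribʳ h f g n = begin
  ((f +ˢ g) ⊛ h) n                       ≡⟨ ⊛-cong≤ {g = h} n (λ m _ → cong (ℤ._+ g m) (sym (ℤ.*-identityˡ (f m)))) (λ _ _ → refl) ⟩
  ((λ m → 1ℤ ℤ.* f m ℤ.+ g m) ⊛ h) n     ≡⟨ ⊛-linearˡ 1ℤ f g h n ⟩
  1ℤ ℤ.* (f ⊛ h) n ℤ.+ (g ⊛ h) n         ≡⟨ cong (ℤ._+ (g ⊛ h) n) (ℤ.*-identityˡ ((f ⊛ h) n)) ⟩
  (f ⊛ h) n ℤ.+ (g ⊛ h) n                ∎
  where open ≡-Reasoning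

seriesRing : CommutativeRing 0ℓ 0ℓ
seriesRing = record
  { Carrier = Series ; _≈_ = _≈_ ; _+_ = _+ˢ_ ; _*_ = _⊛_ ; -_ = -ˢ_ ; 0# = 0ˢ ; 1# = 1ˢ
  ; isCommutativeRing = record
    { isRing = record
      { +-isAbelianGroup = record
        { isGroup = record
          { isMonoid = record
            { isSemigroup = record
              { isMagma = record
                { isEquivalence = record
                  { refl = pointwise λ _ → refl
                  ; sym = λ e → pointwise λ n → sym (at e n)
                  ; trans = λ d e → pointwise λ n → trans (at d n) (at e n)
                  }
                ; ∙-cong = λ d e → pointwise λ n → cong₂ ℤ._+_ (at d n) (at e n)
                }
              ; assoc = λ f g h → pointwise λ n → ℤ.+-assoc (f n) (g n) (h n)
              }
            ; identity = (λ f → pointwise λ n → ℤ.+-identityˡ (f n)) , (λ f → pointwise λ n → ℤ.+-identityʳ (f n))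
            }
          ; inverse = (λ f → pointwise λ n → ℤ.+-inverseˡ (f n)) , (λ f → pointwise λ n → ℤ.+-inverseʳ (f n))
          ; ⁻¹-cong = λ e → pointwise λ n → cong ℤ.-_ (at e n)
          }
        ; comm = λ f g → pointwise λ n → ℤ.+-comm (f n) (g n)
        }
      ; *-cong = λ d e → pointwise λ n → ⊛-cong≤ n (λ m _ → at d m) (λ m _ → at e m)
      ; *-assoc = λ f g h → pointwise (⊛-assoc f g h)
      ; *-identity = (λ f → pointwise (⊛-identityˡ f)) ,
                     (λ f → pointwise λ n → trans (⊛-comm f 1ˢ n) (⊛-identityˡ f n))
      ; distrib = (λ h f g → pointwise λ n → trans (⊛-comm h (f +ˢ g) n)
                     (trans (⊛-distribʳ h f g n) (cong₂ ℤ._+_ (⊛-comm f h n) (⊛-comm g h n)))) ,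
                  (λ h f g → pointwise (⊛-distribʳ h f g))
      }
    ; *-comm = λ f g → pointwise (⊛-comm f g)
    }
  }

module R = CommutativeRing seriesRing
open Products seriesRing
open import Algebra.Properties.CommutativeSemiring.Exp R.commutativeSemiring using (_^_)
open import Algebra.Properties.Ring R.ring using (-‿distribˡ-*; -‿distribʳ-*; -‿involutive)

-- Infinite products

^ˢ≈^ : ∀ f n → f ^ˢ n ≈ f ^ n
^ˢ≈^ f zero    = R.refl
^ˢ≈^ f (suc n) = R.*-congˡ (^ˢ≈^ f n)

poch≈∏ : ∀ a b N → poch a b N ≈ ∏ 1ˢ (-ˢ a) b N
poch≈∏ a b zero    = R.refl
poch≈∏ a b (suc N) = R.*-cong (poch≈∏ a b N)
  (R.trans (R.+-congˡ {1ˢ} (R.-‿cong (R.*-congˡ {a} (^ˢ≈^ b N)))) (R.+-congˡ {1ˢ} (-‿distribˡ-* a (b ^ N))))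

∞≡∏ : ∀ a b → b 0 ≡ 0ℤ → ∀ {n N} → n < N → ⟨ a ⨾ b ⟩∞ n ≡ ∏ 1ˢ (-ˢ a) b N n
∞≡∏ a b b₀ {n} {N} n<N = begin
  ⟨ a ⨾ b ⟩∞ n                   ≡⟨ poch-stable a b b₀ n (N ∸ suc n) ⟨
  poch a b (N ∸ suc n ℕ.+ suc n) n ≡⟨ cong (λ M → poch a b M n) (ℕ.m∸n+n≡m n<N) ⟩
  poch a b N n                   ≡⟨ at (poch≈∏ a b N) n ⟩
  ∏ 1ˢ (-ˢ a) b N n              ∎
  where open ≡-Reasoning

inverseʳ : ∀ f → f 0 ≡ 1ℤ → f ⊛ (1ˢ ÷ f) ≈ 1ˢ
inverseʳ f f₀ = R.trans (R.*-comm f (1ˢ ÷ f)) (pointwise (÷-correct 1ˢ f f₀))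

-- Euler's identities

q q² : Series
q = q^ 1
q² = q^ 2

q^suc-⊛ : ∀ e f n → (q^ suc e ⊛ f) (suc n) ≡ (q^ e ⊛ f) n
q^suc-⊛ e f n = ℤ.+-identityˡ ((q^ e ⊛ f) n)

q^-+ : ∀ d e → q^ d ⊛ q^ e ≈ q^ (d ℕ.+ e)
q^-+ d e = pointwise (go d)
  where
  go : ∀ d n → (q^ d ⊛ q^ e) n ≡ (q^ (d ℕ.+ e)) n
  go zero    n       = trans (⊛-cong≤ {g = q^ e} n (λ _ _ → refl) (λ _ _ → refl)) (⊛-identityˡ (q^ e) n)
  go (suc d) zero    = refl
  go (suc d) (suc n) = trans (q^suc-⊛ d (q^ e) n) (go d n)

euler-even-odd : ⟨ q ⨾ q ⟩∞ ≈ ⟨ q ⨾ q² ⟩∞ ⊛ ⟨ q² ⨾ q² ⟩∞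
euler-even-odd = pointwise λ n → let N = suc n in begin
  ⟨ q ⨾ q ⟩∞ n
    ≡⟨ ∞≡∏ q q refl (ℕ.m≤m*n N 2) ⟩
  ∏ 1ˢ (-ˢ q) q (N ℕ.* 2) n
    ≡⟨ at (∏-even-odd 1ˢ (-ˢ q) q N) n ⟩
  (∏ 1ˢ (-ˢ q) (q ⊛ q) N ⊛ ∏ 1ˢ (-ˢ q ⊛ q) (q ⊛ q) N) n
    ≡⟨ at (R.*-cong (∏-cong N (R.refl {1ˢ}) (R.refl { -ˢ q}) (q^-+ 1 1))
                    (∏-cong N (R.refl {1ˢ}) (R.trans (R.sym (-‿distribˡ-* q q)) (R.-‿cong (q^-+ 1 1))) (q^-+ 1 1))) n ⟩
  (∏ 1ˢ (-ˢ q) q² N ⊛ ∏ 1ˢ (-ˢ q²) q² N) n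
    ≡⟨ ⊛-cong≤ n (λ m p → sym (∞≡∏ q q² refl (s≤s p))) (λ m p → sym (∞≡∏ q² q² refl (s≤s p))) ⟩
  (⟨ q ⨾ q² ⟩∞ ⊛ ⟨ q² ⨾ q² ⟩∞) n ∎
  where open ≡-Reasoning

neg-⊛-neg : ∀ f g → -ˢ f ⊛ -ˢ g ≈ f ⊛ g
neg-⊛-neg f g = R.trans (R.sym (-‿distribˡ-* f (-ˢ g)))
  (R.trans (R.-‿cong (R.sym (-‿distribʳ-* f g))) (-‿involutive (f ⊛ g)))

euler-squares : ⟨ -ˢ q ⨾ q ⟩∞ ⊛ ⟨ q ⨾ q ⟩∞ ≈ ⟨ q² ⨾ q² ⟩∞
euler-squares = pointwise λ n → let N = suc n in begin
  (⟨ -ˢ q ⨾ q ⟩∞ ⊛ ⟨ q ⨾ q ⟩∞) n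
    ≡⟨ ⊛-cong≤ n (λ m p → ∞≡∏ (-ˢ q) q refl (s≤s p)) (λ m p → ∞≡∏ q q refl (s≤s p)) ⟩
  (∏ 1ˢ (-ˢ -ˢ q) q N ⊛ ∏ 1ˢ (-ˢ q) q N) n
    ≡⟨ ⊛-comm (∏ 1ˢ (-ˢ -ˢ q) q N) (∏ 1ˢ (-ˢ q) q N) n ⟩
  (∏ 1ˢ (-ˢ q) q N ⊛ ∏ 1ˢ (-ˢ -ˢ q) q N) n
    ≡⟨ at (∏-difference-of-squares (-ˢ q) q N) n ⟩
  ∏ 1ˢ (-ˢ (-ˢ q ⊛ -ˢ q)) (q ⊛ q) N n
    ≡⟨ at (∏-cong N (R.refl {1ˢ}) (R.-‿cong (R.trans (neg-⊛-neg q q) (q^-+ 1 1))) (q^-+ 1 1)) n ⟩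
  ∏ 1ˢ (-ˢ q²) q² N n
    ≡⟨ ∞≡∏ q² q² refl (ℕ.n<1+n n) ⟨
  ⟨ q² ⨾ q² ⟩∞ n ∎
  where open ≡-Reasoning

theta : ℕ → ℕ → Series
theta i j = ⟨ q^ i ⨾ q^ (i ℕ.+ j) ⟩∞ ⊛ ⟨ q^ j ⨾ q^ (i ℕ.+ j) ⟩∞ ⊛ ⟨ q^ (i ℕ.+ j) ⨾ q^ (i ℕ.+ j) ⟩∞

S-mod-4 : ∀ i j → ∃[ z ] S (i ℕ.+ j) i ≈ theta 1 1 ⊛ theta i j +ˢ ((z +ˢ z) +ˢ (z +ˢ z))
S-mod-4 i j = quotient-mod-4 {h = h}
  (pointwise λ n → trans (S-correct (i ℕ.+ j) i n)
    (cong (λ m → (⟨ -ˢ q ⨾ q ⟩∞ ⊛ (⟨ q^ i ⨾ q^ (i ℕ.+ j) ⟩∞ ⊛ ⟨ q^ m ⨾ q^ (i ℕ.+ j) ⟩∞ ⊛ ⟨ q^ (i ℕ.+ j) ⨾ q^ (i ℕ.+ j) ⟩∞)) n)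
      (ℕ.m+n∸m≡n i j)))
  euler-even-odd euler-squares gap
  (inverseʳ ⟨ q ⨾ q ⟩∞ refl) (inverseʳ ⟨ -ˢ q ⨾ q ⟩∞ refl)
  where
  h : Series
  h n = halfGap (-ˢ q) q (suc n) n
  gap : ⟨ -ˢ q ⨾ q ⟩∞ ≈ ⟨ q ⨾ q ⟩∞ +ˢ (h +ˢ h)
  gap = pointwise λ n → begin
    ⟨ -ˢ q ⨾ q ⟩∞ n             ≡⟨ ∞≡∏ (-ˢ q) q refl (ℕ.n<1+n n) ⟩
    ∏ 1ˢ (-ˢ -ˢ q) q (suc n) n  ≡⟨ at (∏-neg (-ˢ q) q (suc n)) n ⟩
    ∏ 1ˢ (-ˢ q) q (suc n) n ℤ.+ (h n ℤ.+ h n)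
      ≡⟨ cong (ℤ._+ (h n ℤ.+ h n)) (∞≡∏ q q refl (ℕ.n<1+n n)) ⟨
    ⟨ q ⨾ q ⟩∞ n ℤ.+ (h n ℤ.+ h n) ∎
    where open ≡-Reasoning

-- The support of the triple product

q^-⊛-shift : ∀ e f n → (q^ e ⊛ f) (e ℕ.+ n) ≡ f n
q^-⊛-shift zero    f n = trans (⊛-cong≤ {g = f} n (λ _ _ → refl) (λ _ _ → refl)) (⊛-identityˡ f n)
q^-⊛-shift (suc e) f n = trans (q^suc-⊛ e f (e ℕ.+ n)) (q^-⊛-shift e f n)

q^-⊛-vanishes : ∀ e f → (Vanishes< e) (q^ e ⊛ f)
q^-⊛-vanishes (suc e) f zero    p       = refl
q^-⊛-vanishes (suc e) f (suc n) (s≤s p) = trans (q^suc-⊛ e f n) (q^-⊛-vanishes e f n p)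

q^-^ : ∀ e a → (q^ e) ^ a ≈ q^ (a ℕ.* e)
q^-^ e zero    = pointwise λ _ → refl
q^-^ e (suc a) = R.trans (R.*-congˡ {q^ e} (q^-^ e a)) (q^-+ e (a ℕ.* e))

data ±q^ (e : ℕ) (f : Series) : Set where
  pos : f ≈ q^ e → ±q^ e f
  neg : f ≈ -ˢ (q^ e) → ±q^ e f

±q^-* : ∀ {d e f g} → ±q^ d f → ±q^ e g → ±q^ (d ℕ.+ e) (f ⊛ g)
±q^-* {d} {e} (pos x) (pos y) = pos (R.trans (R.*-cong x y) (q^-+ d e))
±q^-* {d} {e} (pos x) (neg y) = neg (R.trans (R.*-cong x y)
  (R.trans (R.sym (-‿distribʳ-* (q^ d) (q^ e))) (R.-‿cong (q^-+ d e))))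
±q^-* {d} {e} (neg x) (pos y) = neg (R.trans (R.*-cong x y)
  (R.trans (R.sym (-‿distribˡ-* (q^ d) (q^ e))) (R.-‿cong (q^-+ d e))))
±q^-* {d} {e} (neg x) (neg y) = pos (R.trans (R.*-cong x y)
  (R.trans (neg-⊛-neg (q^ d) (q^ e)) (q^-+ d e)))

±q^-^ : ∀ {e f} a → ±q^ e f → ±q^ (a ℕ.* e) (f ^ a)
±q^-^ zero    s = pos (pointwise λ _ → refl)
±q^-^ (suc a) s = ±q^-* s (±q^-^ a s)

±q^-⊛-vanishes : ∀ {e f} → ±q^ e f → ∀ g → (Vanishes< e) (f ⊛ g)
±q^-⊛-vanishes {e} (pos x) g n p = trans (at (R.*-congʳ {g} x) n) (q^-⊛-vanishes e g n p)
±q^-⊛-vanishes {e} (neg x) g n p = trans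
  (at (R.trans (R.*-congʳ {g} x) (R.sym (-‿distribˡ-* (q^ e) g))) n)
  (cong ℤ.-_ (q^-⊛-vanishes e g n p))

±q^-⊛-shift : ∀ {e f} → ±q^ e f → ∀ g n →
  (f ⊛ g) (e ℕ.+ n) ≡ g n ⊎ (f ⊛ g) (e ℕ.+ n) ≡ ℤ.- g n
±q^-⊛-shift {e} (pos x) g n = inj₁ (trans (at (R.*-congʳ {g} x) (e ℕ.+ n)) (q^-⊛-shift e g n))
±q^-⊛-shift {e} (neg x) g n = inj₂ (trans
  (at (R.trans (R.*-congʳ {g} x) (R.sym (-‿distribˡ-* (q^ e) g))) (e ℕ.+ n))
  (cong ℤ.-_ (q^-⊛-shift e g n)))

±q^-⊛-zero : ∀ {e f} → ±q^ e f → ∀ g n → g n ≡ 0ℤ → (f ⊛ g) (e ℕ.+ n) ≡ 0ℤ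
±q^-⊛-zero s g n g₀ with ±q^-⊛-shift s g n
... | inj₁ eq = trans eq g₀
... | inj₂ eq = trans eq (cong ℤ.-_ g₀)

±q^-⊛-zero⁻¹ : ∀ {e f} → ±q^ e f → ∀ g n → (f ⊛ g) (e ℕ.+ n) ≡ 0ℤ → g n ≡ 0ℤ
±q^-⊛-zero⁻¹ s g n z with ±q^-⊛-shift s g n
... | inj₁ eq = trans (sym eq) z
... | inj₂ eq = ℤ.neg-injective (trans (sym eq) z)

Σ-vanishes : ∀ F M n → (∀ a b → a ℕ.+ b ≡ M → F a b n ≡ 0ℤ) → Σ⟨ F ⟩ M n ≡ 0ℤ
Σ-vanishes F zero    n z = z 0 0 refl
Σ-vanishes F (suc M) n z = cong₂ ℤ._+_ (z 0 (suc M) refl)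
  (Σ-vanishes (λ a b → F (suc a) b) M n (λ a b p → z (suc a) b (cong suc p)))

module _ (k : ℕ) .{{_ : ℕ.NonZero k}} where

  q^₀ : ∀ e .{{_ : ℕ.NonZero e}} → (q^ e) 0 ≡ 0ℤ
  q^₀ (suc e) = refl

  E : Series
  E = ⟨ q^ k ⨾ q^ k ⟩∞

  fac-suc-stable : ∀ a {m} → m < suc a ℕ.* k → fac (q^ k) (suc a) m ≡ fac (q^ k) a m
  fac-suc-stable a {m} p = begin
    fac (q^ k) (suc a) m
      ≡⟨ at (R.*-congˡ {fac (q^ k) a} (R.+-congˡ {1ˢ} (R.sym (-‿distribˡ-* (q^ k) ((q^ k) ^ a))))) m ⟩
    (fac (q^ k) a ⊛ (1ˢ -ˢ (q^ k) ^ suc a)) m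
      ≡⟨ ⊛-1-vanishing (fac (q^ k) a) ((q^ k) ^ suc a) vanishes m p ⟩
    fac (q^ k) a m ∎
    where
    open ≡-Reasoning
    vanishes : (Vanishes< (suc a ℕ.* k)) ((q^ k) ^ suc a)
    vanishes n n< = begin
      ((q^ k) ^ suc a) n           ≡⟨ at (q^-^ k (suc a)) n ⟩
      (q^ (suc a ℕ.* k)) n         ≡⟨ at (R.*-identityʳ (q^ (suc a ℕ.* k))) n ⟨
      (q^ (suc a ℕ.* k) ⊛ 1ˢ) n    ≡⟨ q^-⊛-vanishes (suc a ℕ.* k) 1ˢ n n< ⟩
      0ℤ ∎

  fac-stable : ∀ d a {m} → m < suc a ℕ.* k → fac (q^ k) (d ℕ.+ a) m ≡ fac (q^ k) a m
  fac-stable zero    a p = refl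
  fac-stable (suc d) a p = trans
    (fac-suc-stable (d ℕ.+ a) (ℕ.<-≤-trans p (ℕ.*-monoˡ-≤ k (s≤s (ℕ.m≤n+m a d)))))
    (fac-stable d a p)

  E≡fac : ∀ a {m} → m < suc a ℕ.* k → E m ≡ fac (q^ k) a m
  E≡fac a {m} p = trans (∞≡∏ (q^ k) (q^ k) (q^₀ k) (ℕ.m≤m+n (suc m) a)) (fac-stable (suc m) a p)

  E⁻¹ : E ⊛ (1ˢ ÷ E) ≈ 1ˢ
  E⁻¹ = inverseʳ E (E≡fac 0 (ℕ.<-≤-trans (ℕ.>-nonZero⁻¹ k) (ℕ.m≤m+n k 0)))

  binom-E : ∀ a b t → t < suc a ℕ.* k → t < suc b ℕ.* k → (binom (q^ k) a b ⊛ E) t ≡ 1ˢ t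
  binom-E a b t t<a t<b = begin
    (B ⊛ E) t                   ≡⟨ at (R.*-identityʳ (B ⊛ E)) t ⟨
    (B ⊛ E ⊛ 1ˢ) t              ≡⟨ at (R.*-congˡ {B ⊛ E} E⁻¹) t ⟨
    (B ⊛ E ⊛ (E ⊛ (1ˢ ÷ E))) t  ≡⟨ at (R.*-assoc (B ⊛ E) E (1ˢ ÷ E)) t ⟨
    (B ⊛ E ⊛ E ⊛ (1ˢ ÷ E)) t    ≡⟨ ⊛-cong≤ {g = 1ˢ ÷ E} t (λ m p → BEE m p) (λ _ _ → refl) ⟩
    (E ⊛ (1ˢ ÷ E)) t            ≡⟨ at E⁻¹ t ⟩
    1ˢ t                        ∎
    where
    open ≡-Reasoning
    B = binom (q^ k) a b
    BEE : ∀ m → m ≤ t → (B ⊛ E ⊛ E) m ≡ E m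
    BEE m m≤t = begin
      (B ⊛ E ⊛ E) m
        ≡⟨ at (R.*-assoc B E E) m ⟩
      (B ⊛ (E ⊛ E)) m
        ≡⟨ ⊛-cong≤ {f = B} m (λ _ _ → refl) (λ l l≤m → ⊛-cong≤ l
             (λ u u≤l → E≡fac a (ℕ.≤-<-trans (ℕ.≤-trans u≤l (ℕ.≤-trans l≤m m≤t)) t<a))
             (λ u u≤l → E≡fac b (ℕ.≤-<-trans (ℕ.≤-trans u≤l (ℕ.≤-trans l≤m m≤t)) t<b))) ⟩
      (B ⊛ (fac (q^ k) a ⊛ fac (q^ k) b)) m
        ≡⟨ at (binom-fac (q^ k) a b) m ⟩
      fac (q^ k) (a ℕ.+ b) m
        ≡⟨ E≡fac (a ℕ.+ b) (ℕ.≤-<-trans m≤t (ℕ.<-≤-trans t<b (ℕ.*-monoˡ-≤ k (s≤s (ℕ.m≤n+m b a))))) ⟨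
      E m ∎

tri-+ : ∀ m n → tri (m ℕ.+ n) ≡ tri m ℕ.+ tri n ℕ.+ m ℕ.* n
tri-+ zero    n = sym (ℕ.+-identityʳ (tri n))
tri-+ (suc m) n = trans (cong (m ℕ.+ n ℕ.+_) (tri-+ m n)) (lem m n (tri m) (tri n))
  where
  lem : ∀ m n x y → m ℕ.+ n ℕ.+ (x ℕ.+ y ℕ.+ m ℕ.* n) ≡ m ℕ.+ x ℕ.+ y ℕ.+ (n ℕ.+ m ℕ.* n)
  lem = ℕ-Ring.solve-∀

tri-square : ∀ n → n ℕ.* n ≡ tri n ℕ.+ tri n ℕ.+ n
tri-square zero    = refl
tri-square (suc n) = trans (cong (λ x → suc (n ℕ.+ x)) (ℕ.*-suc n n))
  (trans (cong (λ x → suc (n ℕ.+ (n ℕ.+ x))) (tri-square n)) (lem n (tri n)))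
  where
  lem : ∀ n x → suc (n ℕ.+ (n ℕ.+ (x ℕ.+ x ℕ.+ n))) ≡ n ℕ.+ x ℕ.+ (n ℕ.+ x) ℕ.+ suc n
  lem = ℕ-Ring.solve-∀

n≤1+tri : ∀ n → n ≤ suc (tri n)
n≤1+tri zero          = z≤n
n≤1+tri (suc zero)    = s≤s z≤n
n≤1+tri (suc (suc n)) = s≤s (s≤s (ℕ.m≤m+n n (n ℕ.+ tri n)))

split-double : ∀ a b N → a ℕ.+ b ≡ N ℕ.+ N →
  (∃[ d ] a ≡ N ℕ.+ d × N ≡ b ℕ.+ d) ⊎ (∃[ d ] N ≡ a ℕ.+ d × b ≡ N ℕ.+ d)
split-double a b N eq with ℕ.≤-total N a
... | inj₁ N≤a = let d = a ∸ N ; a≡ = sym (ℕ.m+[n∸m]≡n N≤a) in inj₁ (d , a≡ ,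
  sym (ℕ.+-cancelˡ-≡ N (b ℕ.+ d) N (begin
    N ℕ.+ (b ℕ.+ d) ≡⟨ cong (N ℕ.+_) (ℕ.+-comm b d) ⟩
    N ℕ.+ (d ℕ.+ b) ≡⟨ ℕ.+-assoc N d b ⟨
    N ℕ.+ d ℕ.+ b   ≡⟨ cong (ℕ._+ b) a≡ ⟨
    a ℕ.+ b         ≡⟨ eq ⟩
    N ℕ.+ N         ∎)))
  where open ≡-Reasoning
... | inj₂ a≤N = let d = N ∸ a ; N≡ = sym (ℕ.m+[n∸m]≡n a≤N) in inj₂ (d , N≡ ,
  ℕ.+-cancelˡ-≡ a b (N ℕ.+ d) (begin
    a ℕ.+ b         ≡⟨ eq ⟩
    N ℕ.+ N         ≡⟨ cong (N ℕ.+_) N≡ ⟩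
    N ℕ.+ (a ℕ.+ d) ≡⟨ ℕ.+-comm N (a ℕ.+ d) ⟩
    a ℕ.+ d ℕ.+ N   ≡⟨ ℕ.+-assoc a d N ⟩
    a ℕ.+ (d ℕ.+ N) ≡⟨ cong (a ℕ.+_) (ℕ.+-comm d N) ⟩
    a ℕ.+ (N ℕ.+ d) ∎))
  where open ≡-Reasoning

module _ (i j : ℕ) where
  private k = i ℕ.+ j

  -- With Q = q^k and y = -q^i, exponent N a b is the degree of Q^{tri a} y^a (Q^N)^b, and
  -- offset N that of the monomial factored out in finite-triple-product.
  exponent : ℕ → ℕ → ℕ → ℕ
  exponent N a b = tri a ℕ.* k ℕ.+ a ℕ.* i ℕ.+ b ℕ.* (N ℕ.* k)

  offset : ℕ → ℕ
  offset N = N ℕ.* i ℕ.+ tri N ℕ.* k ℕ.+ N ℕ.* (N ℕ.* k)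

  bound : ∀ m l d a b → m ≡ a ℕ.+ d → a ≤ b → m ℕ.* k ≤ tri d ℕ.* k ℕ.+ d ℕ.* l ℕ.+ suc b ℕ.* k
  bound m l d a b refl a≤b = begin
    (a ℕ.+ d) ℕ.* k                          ≡⟨ ℕ.*-distribʳ-+ k a d ⟩
    a ℕ.* k ℕ.+ d ℕ.* k                      ≤⟨ ℕ.+-mono-≤ (ℕ.*-monoˡ-≤ k a≤b) (ℕ.*-monoˡ-≤ k (n≤1+tri d)) ⟩
    b ℕ.* k ℕ.+ (k ℕ.+ tri d ℕ.* k)          ≤⟨ ℕ.m≤m+n _ (d ℕ.* l) ⟩
    b ℕ.* k ℕ.+ (k ℕ.+ tri d ℕ.* k) ℕ.+ d ℕ.* l ≡⟨ lem (b ℕ.* k) k (tri d ℕ.* k) (d ℕ.* l) ⟩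
    tri d ℕ.* k ℕ.+ d ℕ.* l ℕ.+ suc b ℕ.* k  ∎
    where
    open ℕ.≤-Reasoning
    lem : ∀ x k y z → x ℕ.+ (k ℕ.+ y) ℕ.+ z ≡ y ℕ.+ z ℕ.+ (k ℕ.+ x)
    lem = ℕ-Ring.solve-∀

  exponent-split : ∀ N a b → a ℕ.+ b ≡ N ℕ.+ N →
    ∃[ d ] ∃[ l ] (l ≡ i ⊎ l ≡ j)
      × exponent N a b ≡ offset N ℕ.+ (tri d ℕ.* k ℕ.+ d ℕ.* l)
      × N ℕ.* k ≤ tri d ℕ.* k ℕ.+ d ℕ.* l ℕ.+ suc a ℕ.* k
      × N ℕ.* k ≤ tri d ℕ.* k ℕ.+ d ℕ.* l ℕ.+ suc b ℕ.* k
  exponent-split N a b eq with split-double a b N eq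
  ... | inj₁ (d , refl , refl) = d , i , inj₁ refl ,
    trans (cong (λ x → x ℕ.* k ℕ.+ a ℕ.* i ℕ.+ b ℕ.* (N ℕ.* k)) (tri-+ N d)) (lem b d i k (tri N) (tri d)) ,
    bound N i d b a refl (ℕ.≤-trans (ℕ.m≤m+n b d) (ℕ.m≤m+n (b ℕ.+ d) d)) ,
    bound N i d b b refl ℕ.≤-refl
    where
    lem : ∀ b d i k x y →
      (x ℕ.+ y ℕ.+ (b ℕ.+ d) ℕ.* d) ℕ.* k ℕ.+ (b ℕ.+ d ℕ.+ d) ℕ.* i ℕ.+ b ℕ.* ((b ℕ.+ d) ℕ.* k) ≡
      (b ℕ.+ d) ℕ.* i ℕ.+ x ℕ.* k ℕ.+ (b ℕ.+ d) ℕ.* ((b ℕ.+ d) ℕ.* k) ℕ.+ (y ℕ.* k ℕ.+ d ℕ.* i)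
    lem = ℕ-Ring.solve-∀
  ... | inj₂ (d , refl , refl) = d , j , inj₂ refl ,
    (begin
      tri a ℕ.* k ℕ.+ a ℕ.* i ℕ.+ (a ℕ.+ d ℕ.+ d) ℕ.* ((a ℕ.+ d) ℕ.* k)
        ≡⟨ lem₁ a d i k (tri a) ⟩
      r ℕ.+ d ℕ.* d ℕ.* k
        ≡⟨ cong (λ x → r ℕ.+ x ℕ.* k) (tri-square d) ⟩
      r ℕ.+ (tri d ℕ.+ tri d ℕ.+ d) ℕ.* k
        ≡⟨ lem₂ a d i j (tri a) (tri d) ⟩
      N ℕ.* i ℕ.+ (tri a ℕ.+ tri d ℕ.+ a ℕ.* d) ℕ.* k ℕ.+ N ℕ.* (N ℕ.* k) ℕ.+ (tri d ℕ.* k ℕ.+ d ℕ.* j)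
        ≡⟨ cong (λ x → N ℕ.* i ℕ.+ x ℕ.* k ℕ.+ N ℕ.* (N ℕ.* k) ℕ.+ (tri d ℕ.* k ℕ.+ d ℕ.* j)) (tri-+ a d) ⟨
      offset N ℕ.+ (tri d ℕ.* k ℕ.+ d ℕ.* j) ∎) ,
    bound N j d a a refl ℕ.≤-refl ,
    bound N j d a b refl (ℕ.≤-trans (ℕ.m≤m+n a d) (ℕ.m≤m+n (a ℕ.+ d) d))
    where
    open ≡-Reasoning
    r = tri a ℕ.* k ℕ.+ a ℕ.* i ℕ.+ (a ℕ.+ d) ℕ.* ((a ℕ.+ d) ℕ.* k) ℕ.+ a ℕ.* d ℕ.* k
    lem₁ : ∀ a d i k x →
      x ℕ.* k ℕ.+ a ℕ.* i ℕ.+ (a ℕ.+ d ℕ.+ d) ℕ.* ((a ℕ.+ d) ℕ.* k) ≡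
      x ℕ.* k ℕ.+ a ℕ.* i ℕ.+ (a ℕ.+ d) ℕ.* ((a ℕ.+ d) ℕ.* k) ℕ.+ a ℕ.* d ℕ.* k ℕ.+ d ℕ.* d ℕ.* k
    lem₁ = ℕ-Ring.solve-∀
    lem₂ : ∀ a d i j x y →
      x ℕ.* (i ℕ.+ j) ℕ.+ a ℕ.* i ℕ.+ (a ℕ.+ d) ℕ.* ((a ℕ.+ d) ℕ.* (i ℕ.+ j)) ℕ.+ a ℕ.* d ℕ.* (i ℕ.+ j)
        ℕ.+ (y ℕ.+ y ℕ.+ d) ℕ.* (i ℕ.+ j) ≡
      (a ℕ.+ d) ℕ.* i ℕ.+ (x ℕ.+ y ℕ.+ a ℕ.* d) ℕ.* (i ℕ.+ j) ℕ.+ (a ℕ.+ d) ℕ.* ((a ℕ.+ d) ℕ.* (i ℕ.+ j))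
        ℕ.+ (y ℕ.* (i ℕ.+ j) ℕ.+ d ℕ.* j)
    lem₂ = ℕ-Ring.solve-∀

  theta-support : .{{_ : ℕ.NonZero k}} → ∀ n →
    (∀ d l → l ≡ i ⊎ l ≡ j → n ≢ tri d ℕ.* k ℕ.+ d ℕ.* l) → theta i j n ≡ 0ℤ
  theta-support n avoid = begin
    theta i j n
      ≡⟨ ⊛-cong≤ n (λ m m≤n → ⊛-cong≤ m
           (λ l l≤m → ∞≡∏ (q^ i) Q (q^₀ k k) (s≤s (ℕ.≤-trans l≤m m≤n)))
           (λ l l≤m → ∞≡∏ (q^ j) Q (q^₀ k k) (s≤s (ℕ.≤-trans l≤m m≤n)))) (λ _ _ → refl) ⟩
    (X ⊛ E k) n
      ≡⟨ ±q^-⊛-zero⁻¹ scale (X ⊛ E k) n expanded ⟩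
    0ℤ ∎
    where
    open ≡-Reasoning
    N = suc n
    Q y w X : Series
    Q = q^ k
    y = -ˢ (q^ i)
    w = -ˢ (q^ j)
    X = ∏ 1ˢ y Q N ⊛ ∏ 1ˢ w Q N
    A = y ^ N ⊛ Q ^ tri N ⊛ (Q ^ N) ^ N
    ±y : ±q^ i y
    ±y = neg R.refl
    ±Q : ±q^ k Q
    ±Q = pos R.refl
    scale : ±q^ (offset N) A
    scale = ±q^-* (±q^-* (±q^-^ N ±y) (±q^-^ (tri N) ±Q)) (±q^-^ N (±q^-^ N ±Q))
    summand : ∀ a b → a ℕ.+ b ≡ N ℕ.+ N →
      (E k ⊛ (term (Q ^ N) y Q a b ⊛ binom Q a b)) (offset N ℕ.+ n) ≡ 0ℤ
    summand a b eq = trans (at rearrange (offset N ℕ.+ n)) (coefficient (exponent-split N a b eq))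
      where
      BE = binom Q a b ⊛ E k
      rearrange : E k ⊛ (term (Q ^ N) y Q a b ⊛ binom Q a b) ≈ term (Q ^ N) y Q a b ⊛ BE
      rearrange = R.trans (R.*-comm (E k) _) (R.*-assoc (term (Q ^ N) y Q a b) (binom Q a b) (E k))
      ±term : ±q^ (exponent N a b) (term (Q ^ N) y Q a b)
      ±term = ±q^-* (±q^-* (±q^-^ (tri a) ±Q) (±q^-^ a ±y)) (±q^-^ b (±q^-^ N ±Q))
      coefficient : ∃[ d ] ∃[ l ] (l ≡ i ⊎ l ≡ j)
        × exponent N a b ≡ offset N ℕ.+ (tri d ℕ.* k ℕ.+ d ℕ.* l)
        × N ℕ.* k ≤ tri d ℕ.* k ℕ.+ d ℕ.* l ℕ.+ suc a ℕ.* k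
        × N ℕ.* k ≤ tri d ℕ.* k ℕ.+ d ℕ.* l ℕ.+ suc b ℕ.* k →
        (term (Q ^ N) y Q a b ⊛ BE) (offset N ℕ.+ n) ≡ 0ℤ
      coefficient (d , l , l∈ , e≡ , boundᵃ , boundᵇ) with n ℕ.<? tri d ℕ.* k ℕ.+ d ℕ.* l
      ... | yes n<δ = ±q^-⊛-vanishes ±term BE (offset N ℕ.+ n)
        (subst (offset N ℕ.+ n <_) (sym e≡) (ℕ.+-monoʳ-< (offset N) n<δ))
      ... | no n≮δ = trans (cong (term (Q ^ N) y Q a b ⊛ BE) index)
        (±q^-⊛-zero ±term BE t (trans (binom-E k a b t (t< a boundᵃ) (t< b boundᵇ)) (1ˢ-vanishes t≢0)))
        where
        δ = tri d ℕ.* k ℕ.+ d ℕ.* l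
        t = n ∸ δ
        δ+t : δ ℕ.+ t ≡ n
        δ+t = ℕ.m+[n∸m]≡n (ℕ.≮⇒≥ n≮δ)
        index : offset N ℕ.+ n ≡ exponent N a b ℕ.+ t
        index = begin
          offset N ℕ.+ n           ≡⟨ cong (offset N ℕ.+_) δ+t ⟨
          offset N ℕ.+ (δ ℕ.+ t)   ≡⟨ ℕ.+-assoc (offset N) δ t ⟨
          offset N ℕ.+ δ ℕ.+ t     ≡⟨ cong (ℕ._+ t) e≡ ⟨
          exponent N a b ℕ.+ t     ∎
        t≢0 : t ≢ 0
        t≢0 t≡0 = avoid d l l∈ (trans (sym δ+t) (trans (cong (δ ℕ.+_) t≡0) (ℕ.+-identityʳ δ)))
        t< : ∀ c → N ℕ.* k ≤ δ ℕ.+ suc c ℕ.* k → t < suc c ℕ.* k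
        t< c bnd = ℕ.+-cancelˡ-< δ t (suc c ℕ.* k)
          (subst (_< δ ℕ.+ suc c ℕ.* k) (sym δ+t) (ℕ.≤-trans (ℕ.m≤m*n N k) bnd))
        1ˢ-vanishes : ∀ {m} → m ≢ 0 → 1ˢ m ≡ 0ℤ
        1ˢ-vanishes {zero}  m≢0 = contradiction refl m≢0
        1ˢ-vanishes {suc m} _   = refl
    terms = λ a b → term (Q ^ N) y Q a b ⊛ binom Q a b
    yw : y ⊛ w ≈ Q
    yw = R.trans (neg-⊛-neg (q^ i) (q^ j)) (q^-+ i j)
    expanded : (A ⊛ (X ⊛ E k)) (offset N ℕ.+ n) ≡ 0ℤ
    expanded = begin
      (A ⊛ (X ⊛ E k)) (offset N ℕ.+ n)
        ≡⟨ at (R.*-assoc A X (E k)) (offset N ℕ.+ n) ⟨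
      (A ⊛ X ⊛ E k) (offset N ℕ.+ n)
        ≡⟨ at (R.*-congʳ {E k} (finite-triple-product y w Q yw N)) (offset N ℕ.+ n) ⟩
      (Σ⟨ terms ⟩ (N ℕ.+ N) ⊛ E k) (offset N ℕ.+ n)
        ≡⟨ ⊛-comm (Σ⟨ terms ⟩ (N ℕ.+ N)) (E k) (offset N ℕ.+ n) ⟩
      (E k ⊛ Σ⟨ terms ⟩ (N ℕ.+ N)) (offset N ℕ.+ n)
        ≡⟨ at (Σ-* (E k) terms (N ℕ.+ N)) (offset N ℕ.+ n) ⟩
      Σ⟨ (λ a b → E k ⊛ terms a b) ⟩ (N ℕ.+ N) (offset N ℕ.+ n)
        ≡⟨ Σ-vanishes (λ a b → E k ⊛ terms a b) (N ℕ.+ N) (offset N ℕ.+ n) summand ⟩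
      0ℤ ∎

-- Residues modulo 4

+-cong-% : ∀ a b c d → a % 4 ≡ b % 4 → c % 4 ≡ d % 4 → (a ℕ.+ c) % 4 ≡ (b ℕ.+ d) % 4
+-cong-% a b c d e f = trans (%-distribˡ-+ a c 4)
  (trans (cong₂ (λ x y → (x ℕ.+ y) % 4) e f) (sym (%-distribˡ-+ b d 4)))

*-congʳ-% : ∀ a b c → b % 4 ≡ c % 4 → (a ℕ.* b) % 4 ≡ (a ℕ.* c) % 4
*-congʳ-% a b c e = trans (%-distribˡ-* a b 4)
  (trans (cong (λ x → (a % 4 ℕ.* x) % 4) e) (sym (%-distribˡ-* a c 4)))

square-residue : ∀ d → (d ℕ.* d) % 4 < 2
square-residue d = subst (_< 2) (sym (%-distribˡ-* d d 4)) (check (d % 4) (m%n<n d 4))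
  where
  check : ∀ r → r < 4 → (r ℕ.* r) % 4 < 2
  check 0 _ = s≤s z≤n
  check 1 _ = s≤s (s≤s z≤n)
  check 2 _ = s≤s z≤n
  check 3 _ = s≤s (s≤s z≤n)
  check (suc (suc (suc (suc _)))) (s≤s (s≤s (s≤s (s≤s ()))))

exponent-residue-1 : ∀ d k l → k % 4 ≡ 2 → l % 4 ≡ 1 →
  (tri d ℕ.* k ℕ.+ d ℕ.* l) % 4 ≡ (d ℕ.* d) % 4
exponent-residue-1 d k l k% l% =
  trans (+-cong-% (tri d ℕ.* k) (tri d ℕ.* 2) (d ℕ.* l) (d ℕ.* 1)
       (*-congʳ-% (tri d) k 2 k%) (*-congʳ-% d l 1 l%))
    (cong (_% 4) (trans (lem d (tri d)) (sym (tri-square d))))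
  where
  lem : ∀ d x → x ℕ.* 2 ℕ.+ d ℕ.* 1 ≡ x ℕ.+ x ℕ.+ d
  lem = ℕ-Ring.solve-∀

exponent-residue-3 : ∀ d k l → k % 4 ≡ 2 → l % 4 ≡ 3 →
  suc (tri d ℕ.* k ℕ.+ d ℕ.* l) % 4 ≡ (suc d ℕ.* suc d) % 4
exponent-residue-3 d k l k% l% =
  trans (+-cong-% 1 1 (tri d ℕ.* k ℕ.+ d ℕ.* l) (tri d ℕ.* 2 ℕ.+ d ℕ.* 3) refl
      (+-cong-% (tri d ℕ.* k) (tri d ℕ.* 2) (d ℕ.* l) (d ℕ.* 3)
      (*-congʳ-% (tri d) k 2 k%) (*-congʳ-% d l 3 l%)))
    (cong (_% 4) (trans (lem d (tri d)) (sym (tri-square (suc d)))))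
  where
  lem : ∀ d x → 1 ℕ.+ (x ℕ.* 2 ℕ.+ d ℕ.* 3) ≡ (d ℕ.+ x) ℕ.+ (d ℕ.+ x) ℕ.+ suc d
  lem = ℕ-Ring.solve-∀

theta-1-1-vanishes : ∀ n → 2 ≤ n % 4 → theta 1 1 n ≡ 0ℤ
theta-1-1-vanishes n 2≤n% = theta-support 1 1 n λ d l l∈ n≡ → ℕ.<⇒≱
  (subst (_< 2) (sym (trans (cong (_% 4) n≡) (exponent-residue-1 d 2 l refl (l% l∈)))) (square-residue d))
  2≤n%
  where
  l% : ∀ {l} → l ≡ 1 ⊎ l ≡ 1 → l % 4 ≡ 1
  l% (inj₁ refl) = refl
  l% (inj₂ refl) = refl

theta-vanishes : ∀ i j .{{_ : ℕ.NonZero (i ℕ.+ j)}} → (i ℕ.+ j) % 4 ≡ 2 → i % 4 ≡ 3 →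
  ∀ n → 2 ≤ suc n % 4 → theta i j n ≡ 0ℤ
theta-vanishes i j k% i% n 2≤n% = theta-support i j n λ d l l∈ n≡ → ℕ.<⇒≱
  (subst (_< 2) (sym (trans (cong (λ m → suc m % 4) n≡) (exponent-residue-3 d (i ℕ.+ j) l k% (l% l∈))))
    (square-residue (suc d)))
  2≤n%
  where
  lem : ∀ i j → j ℕ.+ i ℕ.* 4 ≡ (i ℕ.+ j) ℕ.+ 3 ℕ.* i
  lem = ℕ-Ring.solve-∀
  j% : j % 4 ≡ 3
  j% = trans (sym ([m+kn]%n≡m%n j i 4)) (trans (cong (_% 4) (lem i j))
    (+-cong-% (i ℕ.+ j) 2 (3 ℕ.* i) (3 ℕ.* 3) k% (*-congʳ-% 3 i 3 i%)))
  l% : ∀ {l} → l ≡ i ⊎ l ≡ j → l % 4 ≡ 3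
  l% (inj₁ refl) = i%
  l% (inj₂ refl) = j%

theta-product-vanishes : ∀ i j .{{_ : ℕ.NonZero (i ℕ.+ j)}} → (i ℕ.+ j) % 4 ≡ 2 → i % 4 ≡ 3 →
  ∀ n → n % 4 ≡ 2 → (theta 1 1 ⊛ theta i j) n ≡ 0ℤ
theta-product-vanishes i j k% i% n n% = ⊛-zero (theta 1 1) (theta i j) n one-vanishes
  where
  one-vanishes : ∀ a b → a ℕ.+ b ≡ n → theta 1 1 a ≡ 0ℤ ⊎ theta i j b ≡ 0ℤ
  one-vanishes a b a+b≡n with 2 ℕ.≤? a % 4 | 2 ℕ.≤? suc b % 4
  ... | yes 2≤a | _ = inj₁ (theta-1-1-vanishes a 2≤a)
  ... | no _ | yes 2≤b = inj₂ (theta-vanishes i j k% i% b 2≤b)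
  ... | no 2≰a | no 2≰b = contradiction (subst (_≤ 2) sum (ℕ.+-mono-≤ a≤1 b≤1)) λ { (s≤s (s≤s ())) }
    where
    open ≡-Reasoning
    a≤1 : a % 4 ≤ 1
    a≤1 = ℕ.s≤s⁻¹ (ℕ.≰⇒> 2≰a)
    b≤1 : suc b % 4 ≤ 1
    b≤1 = ℕ.s≤s⁻¹ (ℕ.≰⇒> 2≰b)
    sum : a % 4 ℕ.+ suc b % 4 ≡ 3
    sum = begin
      a % 4 ℕ.+ suc b % 4         ≡⟨ m<n⇒m%n≡m (s≤s (ℕ.m≤n⇒m≤1+n (ℕ.+-mono-≤ a≤1 b≤1))) ⟨
      (a % 4 ℕ.+ suc b % 4) % 4   ≡⟨ %-distribˡ-+ a (suc b) 4 ⟨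
      (a ℕ.+ suc b) % 4           ≡⟨ cong (_% 4) (trans (ℕ.+-suc a b) (cong suc a+b≡n)) ⟩
      suc n % 4                   ≡⟨ +-cong-% 1 1 n 2 refl n% ⟩
      3 ∎

open import Data.Nat using (_+_; _*_)

mainTheorem6 : (k i : ℕ) → 1 ≤ i → 2 * i ≤ k → k % 4 ≡ 2 → i % 4 ≡ 3 →
    (n : ℕ) → (+ 4) ∣ S k i (4 * n + 2)
mainTheorem6 k i 1≤i 2i≤k k% i% n =
  subst (λ k → (+ 4) ∣ S k i m) i+j≡k
    (Signed.∣⇒∣ᵤ (Signed.divides (z m) (begin
      S (i + j) i m                                              ≡⟨ at S≈ m ⟩
      (theta 1 1 ⊛ theta i j) m ℤ.+ (z m ℤ.+ z m ℤ.+ (z m ℤ.+ z m))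
        ≡⟨ cong (ℤ._+ (z m ℤ.+ z m ℤ.+ (z m ℤ.+ z m))) (theta-product-vanishes i j k%′ i% m m%) ⟩
      0ℤ ℤ.+ (z m ℤ.+ z m ℤ.+ (z m ℤ.+ z m))                     ≡⟨ fourfold (z m) ⟩
      z m ℤ.* + 4                                                ∎)))
  where
  open ≡-Reasoning
  m = 4 * n + 2
  j = k ∸ i
  i+j≡k : i + j ≡ k
  i+j≡k = ℕ.m+[n∸m]≡n (ℕ.≤-trans (ℕ.m≤n*m i 2) 2i≤k)
  k%′ : (i + j) % 4 ≡ 2
  k%′ = trans (cong (_% 4) i+j≡k) k%
  instance
    nonZero : ℕ.NonZero (i + j)
    nonZero = ℕ.>-nonZero (ℕ.≤-trans 1≤i (ℕ.m≤m+n i j))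
  z = proj₁ (S-mod-4 i j)
  S≈ = proj₂ (S-mod-4 i j)
  m% : m % 4 ≡ 2
  m% = trans (cong (_% 4) (trans (ℕ.+-comm (4 * n) 2) (cong (2 ℕ.+_) (ℕ.*-comm 4 n)))) ([m+kn]%n≡m%n 2 n 4)
  fourfold : ∀ x → 0ℤ ℤ.+ (x ℤ.+ x ℤ.+ (x ℤ.+ x)) ≡ x ℤ.* + 4
  fourfold = solve-∀
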